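{- Let $\mathrm{a}_{n,k}^{\mathrm{pk}}(213,312)$ denote the number of permutations of $\{1,\dots,n\}$ that avoid both $213$ and $312$ and have exactly $k$ peaks. Then $$\mathrm{a}_{n,k}^{\mathrm{pk}}(213,312)=\begin{cases}2,&k=0;\\ 2^{n-1}-2,&k=1;\\ 0,&\text{otherwise}.\end{cases}$$
   Context: $\mathcal{S}_n$ is the set of permutations $\pi=\pi_1\cdots\pi_n$ of $\{1,\dots,n\}$. For $\rho\in\mathcal{S}_m$, $\pi\in\mathcal{S}_n$ contains $\rho$ if there are indices $1\le i_1<\cdots<i_m\le n$ such that $\pi_{i_a}<\pi_{i_b}$ if and only if $\rho_a<\rho_b$; otherwise $\pi$ avoids $\rho$. The number of peaks is $\mathrm{pk}(\pi)=|\{i:\pi_i<\pi_{i+1}\text{ and }\pi_{i+1}>\pi_{i+2}\}|$, where $1\le i\le n-2$.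
   Formalization: The formula is proved for n ≥ 2; as displayed it fails for n = 0 and n = 1, where there is just one permutation, with no peaks, so the count for k = 0 is 1 rather than 2, and the value for k = 1 would be negative. -}

module Defs where

open import Data.Fin using (Fin; zero; suc; inject₁; _<_; _>_)
open import Data.Fin.Patterns using (0F; 1F; 2F)
open import Data.Fin.Permutation using (Permutation′; permutation; _⟨$⟩ʳ_)
open import Data.Fin.Properties using (_<?_)
open import Data.Nat using (ℕ; zero; suc; _∸_; _^_)
open import Data.Product using (Σ; ∃; _×_; _,_)
open import Data.Vec using (allFin; count)
open import Function using (_⇔_; Inverse)
open import Level using (Level; 0ℓ; _⊔_)
open import Relation.Binary using (Setoid; _Preserves_⟶_)
import Relation.Binary.Construct.On as On
open import Relation.Binary.PropositionalEquality
  using (_≡_; refl; setoid; _→-setoid_)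
open import Relation.Nullary using (¬_; Dec)
open import Relation.Nullary.Decidable using (_×-dec_)

private
  variable
    m n : ℕ

-- Positions and values are numbered from 0: π ⟨$⟩ʳ i is the (i+1)-st letter
-- of π, minus one.

Contains : Permutation′ n → Permutation′ m → Set
Contains {n} {m} π ρ =
  Σ (Fin m → Fin n) λ ι →
    (ι Preserves _<_ ⟶ _<_) ×
    (∀ a b → (π ⟨$⟩ʳ ι a < π ⟨$⟩ʳ ι b) ⇔ (ρ ⟨$⟩ʳ a < ρ ⟨$⟩ʳ b))

Avoids : Permutation′ n → Permutation′ m → Set
Avoids π ρ = ¬ Contains π ρ

-- The three consecutive positions starting at i are i, i+1 and i+2.
PeakAt : Permutation′ (suc (suc m)) → Fin m → Set
PeakAt π i =
  (π ⟨$⟩ʳ inject₁ (inject₁ i) < π ⟨$⟩ʳ inject₁ (suc i)) ×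
  (π ⟨$⟩ʳ inject₁ (suc i) > π ⟨$⟩ʳ suc (suc i))

peakAt? : (π : Permutation′ (suc (suc m))) (i : Fin m) → Dec (PeakAt π i)
peakAt? π i = (_ <? _) ×-dec (_ <? _)

pk : Permutation′ n → ℕ
pk {zero}        π = 0
pk {suc zero}    π = 0
pk {suc (suc m)} π = count (peakAt? π) (allFin m)

-- An involution: its own inverse.
pattern213 : Permutation′ 3
pattern213 = permutation f f inv inv
  where
  f : Fin 3 → Fin 3
  f 0F = 1F
  f 1F = 0F
  f 2F = 2F

  inv : ∀ i → f (f i) ≡ i
  inv 0F = refl
  inv 1F = refl
  inv 2F = refl

pattern312 : Permutation′ 3
pattern312 = permutation f g f∘g g∘f
  where
  f g : Fin 3 → Fin 3
  f 0F = 2F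
  f 1F = 0F
  f 2F = 1F

  g 0F = 1F
  g 1F = 2F
  g 2F = 0F

  f∘g : ∀ i → f (g i) ≡ i
  f∘g 0F = refl
  f∘g 1F = refl
  f∘g 2F = refl

  g∘f : ∀ i → g (f i) ≡ i
  g∘f 0F = refl
  g∘f 1F = refl
  g∘f 2F = refl

-- Elements are identified when their underlying permutations agree at every
-- position; the proofs of avoidance and of the peak count are irrelevant.
AvoidersWithPeaks : ∀ {l} → Permutation′ l → Permutation′ m →
                    (n k : ℕ) → Setoid 0ℓ 0ℓ
AvoidersWithPeaks ρ σ n k =
  On.setoid {B = ∃ λ (π : Permutation′ n) → Avoids π ρ × Avoids π σ × pk π ≡ k}
    (Fin n →-setoid Fin n)
    (λ (π , _) → π ⟨$⟩ʳ_)

-- The setoid S has exactly c elements up to its equality.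
HasCardinality : ∀ {a ℓ : Level} → Setoid a ℓ → ℕ → Set (a ⊔ ℓ)
HasCardinality S c = Inverse S (setoid (Fin c))

-- The truncated subtraction ∸ agrees with subtraction in ℤ when n ≥ 2.
peakFormula : (n k : ℕ) → ℕ
peakFormula n 0             = 2
peakFormula n 1             = 2 ^ (n ∸ 1) ∸ 2
peakFormula n (suc (suc _)) = 0

{-# OPTIONS --safe #-}

-- Avoiding 213 and 312 means having no valley f j < f i, f k with i < j < k,
-- so the least letter stands first or last, and deleting it leaves a shorter
-- permutation without valleys. Recording the end at each deletion identifies
-- these permutations of n letters with the binary words of length n − 1. Two
-- peaks would enclose a valley, so there is at most one peak, and there is none
-- exactly when the word is constant (the increasing and decreasing permutation).
module Submission where

open import Defs
open import Data.Bool using (Bool; true; false; if_then_else_)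
import Data.Bool.Properties as Bool
open import Data.Empty using (⊥-elim)
open import Data.Fin
  using (Fin; zero; suc; toℕ; fromℕ; inject₁; punchIn; punchOut; _<_; _≤_)
open import Data.Fin.Patterns using (0F; 1F; 2F)
open import Data.Fin.Permutation
  using ( Permutation′; _⟨$⟩ʳ_; _⟨$⟩ˡ_; _≈_; inverseˡ; inverseʳ; cast-id
        ; insert; remove; insert-punchIn; punchIn-permute)
import Data.Fin.Permutation as Perm
open import Data.Fin.Properties
  using ( _≟_; _<?_; <-cmp; <-irrefl; ≤∧≢⇒<; ≤fromℕ
        ; toℕ-inject₁; 0≢1+n; punchIn-mono-≤; punchIn-cancel-≤; punchInᵢ≢i
        ; punchIn-punchOut; punchOut-punchIn; punchOut-cong; suc-injective
        ; 2↔Bool; *↔×)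
open import Data.Nat using (ℕ; zero; suc; pred; _≥_; _^_; z≤n; s≤s)
import Data.Nat as ℕ using (_≤_; _<_)
import Data.Nat.Properties as ℕ
open import Data.Product using (∃; _×_; _,_; proj₁; proj₂)
open import Data.Product.Function.NonDependent.Propositional using (_×-↔_)
open import Data.Vec using (Vec; []; _∷_; allFin; count; replicate; tabulate)
open import Data.Vec.Properties using (≡-dec)
open import Function using (_∘_; id; _⇔_; _↔_; mk⇔; mk↔ₛ′; Inverse; Injection; Equivalence)
open import Function.Construct.Composition using (inverse)
open import Function.Construct.Identity using (↔-id)
open import Function.Properties.Inverse using (↔-sym; ↔-trans; ↔⇒↣)
open import Level using (0ℓ)
open import Relation.Binary
  using (Setoid; DecidableEquality; tri<; tri≈; tri>; _Preserves_⟶_)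
open import Relation.Binary.PropositionalEquality
  using (_≡_; _≢_; refl; sym; trans; cong; subst; subst₂; setoid)
open import Relation.Nullary using (¬_; does; yes; no; contradiction)
open import Relation.Nullary.Decidable using (dec-true; dec-false; does-⇔)
import Relation.Unary as U

private
  variable
    m n : ℕ

-- Valleys

HasNoValley : Permutation′ n → Set
HasNoValley π = ∀ i j k → i < j → j < k →
                π ⟨$⟩ʳ j < π ⟨$⟩ʳ i → ¬ (π ⟨$⟩ʳ j < π ⟨$⟩ʳ k)

triple : ∀ {A : Set} → A → A → A → Fin 3 → A
triple a b c 0F = a
triple a b c 1F = b
triple a b c 2F = c

chain-preserves-< : (g : Fin 3 → Fin n) → g 0F < g 1F → g 1F < g 2F → g Preserves _<_ ⟶ _<_
chain-preserves-< g p q {0F} {1F} _ = p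
chain-preserves-< g p q {0F} {2F} _ = ℕ.<-trans p q
chain-preserves-< g p q {1F} {2F} _ = q
chain-preserves-< g p q {0F} {0F} ()
chain-preserves-< g p q {1F} {0F} ()
chain-preserves-< g p q {1F} {1F} (s≤s ())
chain-preserves-< g p q {2F} {0F} ()
chain-preserves-< g p q {2F} {1F} (s≤s ())
chain-preserves-< g p q {2F} {2F} (s≤s (s≤s ()))

⟨$⟩ʳ-injective : (π : Permutation′ n) {i j : Fin n} → π ⟨$⟩ʳ i ≡ π ⟨$⟩ʳ j → i ≡ j
⟨$⟩ʳ-injective π = Injection.injective (↔⇒↣ π)

-- Reading the chosen letters through `ρ ⟨$⟩ˡ_` lists them by increasing pattern value, so one
-- increasing chain yields the forward half of the order isomorphism. The converse half then follows
-- from trichotomy and injectivity of `ρ`.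
contains : (π : Permutation′ n) (ρ : Permutation′ m) (ι : Fin m → Fin n) →
           ι Preserves _<_ ⟶ _<_ →
           (λ c → π ⟨$⟩ʳ ι (ρ ⟨$⟩ˡ c)) Preserves _<_ ⟶ _<_ → Contains π ρ
contains π ρ ι ι-mono h = ι , ι-mono , λ a b → mk⇔ (reflects a b) (preserves a b)
  where
  preserves : ∀ a b → ρ ⟨$⟩ʳ a < ρ ⟨$⟩ʳ b → π ⟨$⟩ʳ ι a < π ⟨$⟩ʳ ι b
  preserves a b ρa<ρb = subst₂ (λ c d → π ⟨$⟩ʳ ι c < π ⟨$⟩ʳ ι d)
    (inverseˡ ρ) (inverseˡ ρ) (h {ρ ⟨$⟩ʳ a} {ρ ⟨$⟩ʳ b} ρa<ρb)

  reflects : ∀ a b → π ⟨$⟩ʳ ι a < π ⟨$⟩ʳ ι b → ρ ⟨$⟩ʳ a < ρ ⟨$⟩ʳ b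
  reflects a b πa<πb with <-cmp (ρ ⟨$⟩ʳ a) (ρ ⟨$⟩ʳ b)
  ... | tri< ρa<ρb _ _ = ρa<ρb
  ... | tri> _ _ ρb<ρa =
    contradiction (preserves b a ρb<ρa) (ℕ.<-asym πa<πb)
  ... | tri≈ _ ρa≡ρb _ = contradiction πa<πb
    (<-irrefl (cong (λ c → π ⟨$⟩ʳ ι c) (⟨$⟩ʳ-injective ρ ρa≡ρb)))

-- The middle letter of a valley is the least of the three, so only the outer two remain to be
-- compared: an ascent gives 213, a descent 312.
avoids⇒noValley : (π : Permutation′ n) → Avoids π pattern213 → Avoids π pattern312 →
                  HasNoValley π
avoids⇒noValley π ¬213 ¬312 i j k i<j j<k fj<fi fj<fk
  with <-cmp (π ⟨$⟩ʳ i) (π ⟨$⟩ʳ k)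
... | tri< fi<fk _ _ = ¬213 (contains π pattern213 (triple i j k)
        (chain-preserves-< (triple i j k) i<j j<k)
        (chain-preserves-< (λ c → π ⟨$⟩ʳ triple i j k (pattern213 ⟨$⟩ˡ c)) fj<fi fi<fk))
... | tri> _ _ fk<fi = ¬312 (contains π pattern312 (triple i j k)
        (chain-preserves-< (triple i j k) i<j j<k)
        (chain-preserves-< (λ c → π ⟨$⟩ʳ triple i j k (pattern312 ⟨$⟩ˡ c)) fj<fk fk<fi))
... | tri≈ _ fi≡fk _ = <-irrefl (⟨$⟩ʳ-injective π fi≡fk) (ℕ.<-trans i<j j<k)

-- An occurrence of a pattern whose least letter is in the middle is itself a valley; 213 and 312
-- are both of this kind.
noValley⇒avoids : (π : Permutation′ n) (ρ : Permutation′ 3) →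
                  ρ ⟨$⟩ʳ 1F < ρ ⟨$⟩ʳ 0F → ρ ⟨$⟩ʳ 1F < ρ ⟨$⟩ʳ 2F →
                  HasNoValley π → Avoids π ρ
noValley⇒avoids π ρ ρ1<ρ0 ρ1<ρ2 nv (ι , ι-mono , iff) =
  nv (ι 0F) (ι 1F) (ι 2F) (ι-mono {0F} {1F} (s≤s z≤n)) (ι-mono {1F} {2F} (s≤s (s≤s z≤n)))
    (Equivalence.from (iff 1F 0F) ρ1<ρ0) (Equivalence.from (iff 1F 2F) ρ1<ρ2)

-- Inserting and deleting the least letter

-- Separates the position of the newly inserted letter from the positions inherited from the shorter
-- permutation.
data PunchView (p : Fin (suc n)) : Fin (suc n) → Set where
  here : PunchView p p
  away : ∀ j → PunchView p (punchIn p j)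

punchView : (p i : Fin (suc n)) → PunchView p i
punchView p i with p ≟ i
... | yes refl = here
... | no p≢i   = subst (PunchView p) (punchIn-punchOut p≢i) (away (punchOut p≢i))

punchIn-mono-< : ∀ p (i j : Fin n) → i < j → punchIn p i < punchIn p j
punchIn-mono-< p i j i<j = ℕ.≰⇒> (ℕ.<⇒≱ i<j ∘ punchIn-cancel-≤ p j i)

punchIn-cancel-< : ∀ p (i j : Fin n) → punchIn p i < punchIn p j → i < j
punchIn-cancel-< p i j lt = ℕ.≰⇒> (ℕ.<⇒≱ lt ∘ punchIn-mono-≤ p j i)

insert-self : ∀ i j (π : Permutation′ n) → insert i j π ⟨$⟩ʳ i ≡ j
insert-self i j π with i ≟ i
... | yes _  = refl
... | no i≢i = contradiction refl i≢i

endpoint : Bool → Fin (suc n)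
endpoint     true  = zero
endpoint {n} false = fromℕ n

-- The index `suc n` provides at least two positions; with a single position the two ends coincide.
endpoint-injective : ∀ x y → endpoint {suc n} x ≡ endpoint y → x ≡ y
endpoint-injective true  true  _ = refl
endpoint-injective false false _ = refl

endpoint-extremal : ∀ x (i k : Fin (suc n)) → i < endpoint {n} x → ¬ (endpoint {n} x < k)
endpoint-extremal true  i k ()
endpoint-extremal false i k _ lt = ℕ.<⇒≱ lt (≤fromℕ k)

-- The head of the word places the least letter and the tail arranges the larger ones. The last
-- remaining letter has no choice of end, which is why a word is one shorter than its permutation.
build : Vec Bool m → Permutation′ (suc m)
build []      = Perm.id
build (x ∷ v) = insert (endpoint x) zero (build v)

build-endpoint : ∀ x (v : Vec Bool m) → build (x ∷ v) ⟨$⟩ʳ endpoint x ≡ zero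
build-endpoint x v = insert-self (endpoint x) zero (build v)

build-punchIn : ∀ x (v : Vec Bool m) j →
                build (x ∷ v) ⟨$⟩ʳ punchIn (endpoint x) j ≡ suc (build v ⟨$⟩ʳ j)
build-punchIn x v = insert-punchIn (endpoint x) zero (build v)

build-punchIn-< : ∀ x (v : Vec Bool m) i j → build v ⟨$⟩ʳ i < build v ⟨$⟩ʳ j →
  build (x ∷ v) ⟨$⟩ʳ punchIn (endpoint x) i < build (x ∷ v) ⟨$⟩ʳ punchIn (endpoint x) j
build-punchIn-< x v i j lt =
  subst₂ _<_ (sym (build-punchIn x v i)) (sym (build-punchIn x v j)) (s≤s lt)

build-punchIn-<⁻¹ : ∀ x (v : Vec Bool m) i j →
  build (x ∷ v) ⟨$⟩ʳ punchIn (endpoint x) i < build (x ∷ v) ⟨$⟩ʳ punchIn (endpoint x) j →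
  build v ⟨$⟩ʳ i < build v ⟨$⟩ʳ j
build-punchIn-<⁻¹ x v i j lt =
  ℕ.≤-pred (subst₂ _<_ (build-punchIn x v i) (build-punchIn x v j) lt)

build-endpoint-min : ∀ x (v : Vec Bool m) j →
  build (x ∷ v) ⟨$⟩ʳ endpoint x < build (x ∷ v) ⟨$⟩ʳ punchIn (endpoint x) j
build-endpoint-min x v j =
  subst₂ _<_ (sym (build-endpoint x v)) (sym (build-punchIn x v j)) (s≤s z≤n)

build-≮endpoint : ∀ x (v : Vec Bool m) i →
  ¬ (build (x ∷ v) ⟨$⟩ʳ i < build (x ∷ v) ⟨$⟩ʳ endpoint x)
build-≮endpoint x v i lt
  with () ← subst (build (x ∷ v) ⟨$⟩ʳ i <_) (build-endpoint x v) lt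

-- The least letter cannot be an outer letter of a valley, since the middle one is smaller, nor the
-- middle one, since it stands at an end. A valley would therefore lie entirely in the permutation
-- of the tail.
build-noValley : (v : Vec Bool m) → HasNoValley (build v)
build-noValley [] 0F 0F k ()
build-noValley (x ∷ v) i j k i<j j<k fj<fi fj<fk
  with punchView (endpoint x) i | punchView (endpoint x) j | punchView (endpoint x) k
... | here   | _      | _      = build-≮endpoint x v j fj<fi
... | away _ | here   | _      = endpoint-extremal x i k i<j j<k
... | away _ | away _ | here   = build-≮endpoint x v j fj<fk
... | away a | away b | away c = build-noValley v a b c
      (punchIn-cancel-< (endpoint x) a b i<j) (punchIn-cancel-< (endpoint x) b c j<k)
      (build-punchIn-<⁻¹ x v b a fj<fi) (build-punchIn-<⁻¹ x v b c fj<fk)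

-- The position of `zero` recovers the head; the other letters, lowered by one, recover the
-- permutation of the tail.
build-injective : (v w : Vec Bool m) → build v ≈ build w → v ≡ w
build-injective []      []      _ = refl
build-injective (x ∷ v) (y ∷ w) e
  with refl ← endpoint-injective x y (⟨$⟩ʳ-injective (build (y ∷ w))
         (trans (sym (e (endpoint x))) (trans (build-endpoint x v) (sym (build-endpoint y w)))))
  = cong (x ∷_) (build-injective v w λ j → suc-injective
      (trans (sym (build-punchIn x v j)) (trans (e _) (build-punchIn x w j))))

-- A least letter strictly inside would form a valley with the first and the last letter.
minimum-at-endpoint : (π : Permutation′ (suc n)) → HasNoValley π →
                      ∃ λ x → π ⟨$⟩ʳ endpoint x ≡ zero
minimum-at-endpoint {n} π nv with π ⟨$⟩ˡ zero ≟ zero | π ⟨$⟩ˡ zero ≟ fromℕ n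
... | yes p≡0 | _         = true  , trans (cong (π ⟨$⟩ʳ_) (sym p≡0)) (inverseʳ π)
... | no _    | yes p≡end = false , trans (cong (π ⟨$⟩ʳ_) (sym p≡end)) (inverseʳ π)
... | no p≢0  | no p≢end  = ⊥-elim (nv zero (π ⟨$⟩ˡ zero) (fromℕ n)
        (≤∧≢⇒< z≤n (p≢0 ∘ sym)) (≤∧≢⇒< (≤fromℕ _) p≢end)
        (above zero p≢0) (above (fromℕ n) p≢end))
  where
  above : ∀ i → π ⟨$⟩ˡ zero ≢ i → π ⟨$⟩ʳ (π ⟨$⟩ˡ zero) < π ⟨$⟩ʳ i
  above i p≢i = ≤∧≢⇒< (subst (_≤ π ⟨$⟩ʳ i) (sym (inverseʳ π)) z≤n)
                      (p≢i ∘ ⟨$⟩ʳ-injective π)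

remove-noValley : ∀ p (π : Permutation′ (suc n)) → HasNoValley π → HasNoValley (remove p π)
remove-noValley p π nv i j k i<j j<k gj<gi gj<gk =
  nv (punchIn p i) (punchIn p j) (punchIn p k)
     (punchIn-mono-< p i j i<j) (punchIn-mono-< p j k j<k) (lift j i gj<gi) (lift j k gj<gk)
  where
  lift : ∀ a b → remove p π ⟨$⟩ʳ a < remove p π ⟨$⟩ʳ b →
         π ⟨$⟩ʳ punchIn p a < π ⟨$⟩ʳ punchIn p b
  lift a b lt = subst₂ _<_ (sym (punchIn-permute π p a)) (sym (punchIn-permute π p b))
    (punchIn-mono-< (π ⟨$⟩ʳ p) _ _ lt)

build-surjective : (π : Permutation′ (suc m)) → HasNoValley π → ∃ λ v → build v ≈ π
build-surjective {zero} π nv = [] , λ where 0F → Fin1-unique (π ⟨$⟩ʳ 0F)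
  where
  Fin1-unique : (i : Fin 1) → 0F ≡ i
  Fin1-unique 0F = refl
build-surjective {suc m} π nv
  with x , π-end ← minimum-at-endpoint π nv
  with v , e ← build-surjective (remove (endpoint x) π) (remove-noValley (endpoint x) π nv)
  = x ∷ v , agree
  where
  agree : build (x ∷ v) ≈ π
  agree i with punchView (endpoint x) i
  ... | here   = trans (build-endpoint x v) (sym π-end)
  -- By `π-end` the deleted value is `zero`, so punching it back into the values is `suc`, the same
  -- shift that `build` applies.
  ... | away j = trans (build-punchIn x v j) (trans (cong suc (e j))
        (sym (trans (punchIn-permute π (endpoint x) j)
                    (cong (λ z → punchIn z (remove (endpoint x) π ⟨$⟩ʳ j)) π-end))))

-- Peaks

-- The function `f` is arbitrary so that the induction can pass to `f ∘ suc`; `allFin` is the case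
-- `f = id`.
count-tabulate≡0 : ∀ {A : Set} {P : U.Pred A 0ℓ} (P? : U.Decidable P) (f : Fin n → A) →
                   (∀ i → ¬ P (f i)) → count P? (tabulate f) ≡ 0
count-tabulate≡0 {zero}  P? f ¬P = refl
count-tabulate≡0 {suc n} P? f ¬P
  rewrite dec-false (P? (f zero)) (¬P zero) = count-tabulate≡0 P? (f ∘ suc) (¬P ∘ suc)

count-tabulate≡1 : ∀ {A : Set} {P : U.Pred A 0ℓ} (P? : U.Decidable P) (f : Fin n → A) i →
                   P (f i) → (∀ j → P (f j) → j ≡ i) → count P? (tabulate f) ≡ 1
count-tabulate≡1 P? f zero p unique
  rewrite dec-true (P? (f zero)) p =
  cong suc (count-tabulate≡0 P? (f ∘ suc) λ j q → contradiction (unique (suc j) q) λ ())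
count-tabulate≡1 P? f (suc i) p unique
  rewrite dec-false (P? (f zero)) (0≢1+n ∘ unique zero) =
  count-tabulate≡1 P? (f ∘ suc) i p λ j q → suc-injective (unique (suc j) q)

count-cong : ∀ {A : Set} {P Q : U.Pred A 0ℓ} (P? : U.Decidable P) (Q? : U.Decidable Q) →
             (∀ x → P x ⇔ Q x) → (xs : Vec A n) → count P? xs ≡ count Q? xs
count-cong P? Q? iff []       = refl
count-cong P? Q? iff (x ∷ xs)
  rewrite does-⇔ (iff x) (P? x) (Q? x) | count-cong P? Q? iff xs = refl

pk-cong : (π ρ : Permutation′ n) → π ≈ ρ → pk π ≡ pk ρ
pk-cong {zero}        π ρ e = refl
pk-cong {suc zero}    π ρ e = refl
pk-cong {suc (suc m)} π ρ e = count-cong (peakAt? π) (peakAt? ρ)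
  (λ i → mk⇔ (transport π ρ e i) (transport ρ π (sym ∘ e) i)) (allFin m)
  where
  transport : ∀ (σ τ : Permutation′ (suc (suc m))) → σ ≈ τ → ∀ i → PeakAt σ i → PeakAt τ i
  transport σ τ e i (up , down) = subst₂ _<_ (e _) (e _) up , subst₂ _<_ (e _) (e _) down

-- Write a₀, a₁, a₂ and b₀, b₁, b₂ for the positions of the two peaks. If the letter at b₀ is below
-- the one at a₁, then a₁, b₀, b₁ is a valley. Otherwise the letters at a₂, a₁, b₀, b₁ weakly
-- increase in this order, strictly at both outer steps, and a₁, a₂, b₁ is a valley.
no-later-peak : (π : Permutation′ (suc (suc m))) → HasNoValley π →
                ∀ i j → i < j → PeakAt π i → ¬ PeakAt π j
no-later-peak π nv i j i<j (_ , f-a₂<f-a₁) (f-b₀<f-b₁ , _)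
  with π ⟨$⟩ʳ inject₁ (inject₁ j) <? π ⟨$⟩ʳ inject₁ (suc i)
... | yes f-b₀<f-a₁ = nv (inject₁ (suc i)) (inject₁ (inject₁ j)) (inject₁ (suc j))
  -- From `i < j` only the weak inequality of positions a₁ ≤ b₀ follows; equality is excluded
  -- because the letters there differ. The same device gives a₂ < b₁ in the other case.
  (≤∧≢⇒< (subst₂ ℕ._<_ (sym (toℕ-inject₁ i))
            (sym (trans (toℕ-inject₁ (inject₁ j)) (toℕ-inject₁ j))) i<j)
         (λ e → <-irrefl (cong (π ⟨$⟩ʳ_) (sym e)) f-b₀<f-a₁))
  (s≤s (ℕ.≤-reflexive (toℕ-inject₁ (inject₁ j))))
  f-b₀<f-a₁ f-b₀<f-b₁
... | no f-b₀≮f-a₁ = nv (inject₁ (suc i)) (suc (suc i)) (inject₁ (suc j))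
  (s≤s (s≤s (ℕ.≤-reflexive (toℕ-inject₁ i))))
  (≤∧≢⇒< (s≤s (subst (toℕ i ℕ.<_) (sym (toℕ-inject₁ j)) i<j))
         (λ e → <-irrefl (cong (π ⟨$⟩ʳ_) e) f-a₂<f-b₁))
  f-a₂<f-a₁ f-a₂<f-b₁
  where
  f-a₂<f-b₁ : π ⟨$⟩ʳ suc (suc i) < π ⟨$⟩ʳ inject₁ (suc j)
  f-a₂<f-b₁ = ℕ.<-trans (ℕ.<-≤-trans f-a₂<f-a₁ (ℕ.≮⇒≥ f-b₀≮f-a₁)) f-b₀<f-b₁

peak-unique : (π : Permutation′ (suc (suc m))) → HasNoValley π →
              ∀ i j → PeakAt π i → PeakAt π j → j ≡ i
peak-unique π nv i j p q with <-cmp i j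
... | tri< i<j _ _ = contradiction q (no-later-peak π nv i j i<j p)
... | tri≈ _ i≡j _ = sym i≡j
... | tri> _ _ j<i = contradiction p (no-later-peak π nv j i j<i q)

-- Constant words and monotone permutations

infix 4 _<[_]_

_<[_]_ : Fin n → Bool → Fin n → Set
i <[ true  ] j = i < j
i <[ false ] j = j < i

-- Putting the least letter first every time gives the increasing permutation, putting it last every
-- time the decreasing one; `_<[ x ]_` states both at once.
build-replicate-mono : ∀ x i j → i < j →
  build (replicate m x) ⟨$⟩ʳ i <[ x ] build (replicate m x) ⟨$⟩ʳ j
build-replicate-mono {zero}  x     0F 0F ()
build-replicate-mono {suc m} x i j i<j
  with punchView (endpoint x) i | punchView (endpoint x) j
... | here   | here   = contradiction i<j (<-irrefl refl)
build-replicate-mono {suc m} true  i j i<j | here   | away b =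
  build-endpoint-min true (replicate m true) b
build-replicate-mono {suc m} false i j i<j | here   | away b =
  contradiction i<j (ℕ.≤⇒≯ (≤fromℕ j))
build-replicate-mono {suc m} true  i j ()  | away a | here
build-replicate-mono {suc m} false i j i<j | away a | here   =
  build-endpoint-min false (replicate m false) a
build-replicate-mono {suc m} true  i j i<j | away a | away b =
  build-punchIn-< true (replicate m true) a b
    (build-replicate-mono true a b (punchIn-cancel-< (endpoint true) a b i<j))
build-replicate-mono {suc m} false i j i<j | away a | away b =
  build-punchIn-< false (replicate m false) b a
    (build-replicate-mono false a b (punchIn-cancel-< (endpoint false) a b i<j))

inject₁²<inject₁suc : (i : Fin m) → inject₁ (inject₁ i) < inject₁ (suc i)
inject₁²<inject₁suc i = s≤s (ℕ.≤-reflexive (toℕ-inject₁ (inject₁ i)))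

inject₁suc<suc² : (i : Fin m) → inject₁ (suc i) < suc (suc i)
inject₁suc<suc² i = s≤s (s≤s (ℕ.≤-reflexive (toℕ-inject₁ i)))

build-replicate-noPeak : ∀ x (i : Fin m) → ¬ PeakAt (build (replicate (suc m) x)) i
build-replicate-noPeak true i (_ , down) =
  ℕ.<-asym down (build-replicate-mono true _ _ (inject₁suc<suc² i))
build-replicate-noPeak false i (up , _) =
  ℕ.<-asym up (build-replicate-mono false _ _ (inject₁²<inject₁suc i))

-- Non-constant words and their peak

_≟ᵛ_ : DecidableEquality (Vec Bool m)
_≟ᵛ_ = ≡-dec Bool._≟_

-- While `punchIn zero` computes to `suc`, `punchIn (fromℕ n)` equals `inject₁` only
-- propositionally. The rewriting brings inequalities into the shape that `PeakAt` expects.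
punchIn-fromℕ : (i : Fin n) → punchIn (fromℕ n) i ≡ inject₁ i
punchIn-fromℕ zero    = refl
punchIn-fromℕ (suc i) = cong suc (punchIn-fromℕ i)

build-inject₁-< : ∀ (v : Vec Bool m) i j → build v ⟨$⟩ʳ i < build v ⟨$⟩ʳ j →
  build (false ∷ v) ⟨$⟩ʳ inject₁ i < build (false ∷ v) ⟨$⟩ʳ inject₁ j
build-inject₁-< v i j lt =
  subst₂ (λ a b → build (false ∷ v) ⟨$⟩ʳ a < build (false ∷ v) ⟨$⟩ʳ b)
    (punchIn-fromℕ i) (punchIn-fromℕ j) (build-punchIn-< false v i j lt)

build-fromℕ-min : ∀ (v : Vec Bool m) j →
  build (false ∷ v) ⟨$⟩ʳ fromℕ (suc m) < build (false ∷ v) ⟨$⟩ʳ inject₁ j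
build-fromℕ-min v j =
  subst (λ b → build (false ∷ v) ⟨$⟩ʳ fromℕ _ < build (false ∷ v) ⟨$⟩ʳ b)
    (punchIn-fromℕ j) (build-endpoint-min false v j)

-- A letter added at an end leaves consecutive letters consecutive and in the same relative order. A
-- peak moves by one position if the letter comes first and keeps its index otherwise.
prepend-peak : ∀ x (v : Vec Bool (suc m)) → ∃ (PeakAt (build v)) → ∃ (PeakAt (build (x ∷ v)))
prepend-peak true v (i , up , down) =
  suc i , build-punchIn-< true v _ _ up , build-punchIn-< true v _ _ down
prepend-peak false v (i , up , down) =
  inject₁ i , build-inject₁-< v _ _ up , build-inject₁-< v _ _ down

-- The repeated bit gives a monotone permutation, and the least letter is attached next to its
-- largest letter, which thereby becomes a peak.
turning-peak : ∀ x y → x ≢ y → ∃ (PeakAt (build (x ∷ replicate (suc m) y)))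
turning-peak true  true  x≢y = contradiction refl x≢y
turning-peak false false x≢y = contradiction refl x≢y
turning-peak {m} true false _ = zero ,
  build-endpoint-min true (replicate (suc m) false) zero ,
  build-punchIn-< true (replicate (suc m) false) 1F 0F
    (build-replicate-mono {suc m} false 0F 1F (s≤s z≤n))
-- The largest letter is next to last here, so the witness is the last triple.
turning-peak {m} false true _ = fromℕ m ,
  build-inject₁-< (replicate (suc m) true) (inject₁ (fromℕ m)) (suc (fromℕ m))
    (build-replicate-mono {suc m} true (inject₁ (fromℕ m)) (suc (fromℕ m))
      (s≤s (ℕ.≤-reflexive (toℕ-inject₁ (fromℕ m))))) ,
  build-fromℕ-min (replicate (suc m) true) (suc (fromℕ m))

-- Bits are peeled off until the remaining tail is constant, that is, down to the last change of
-- bit. The peak arises there and survives each bit put back.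
build-peak : ∀ x (v : Vec Bool m) → v ≢ replicate m x → ∃ (PeakAt (build (x ∷ v)))
build-peak {zero}  x []      v≢ = contradiction refl v≢
build-peak {suc m} x (y ∷ w) v≢ with w ≟ᵛ replicate m y
... | yes refl = turning-peak x y λ { refl → v≢ refl }
... | no w≢    = prepend-peak x (y ∷ w) (build-peak y w w≢)

-- Only nonempty words, hence permutations of at least two letters, are considered: on these the two
-- constant words are distinct.
wordPeaks : Vec Bool (suc m) → ℕ
wordPeaks {m} (x ∷ v) = if does (v ≟ᵛ replicate m x) then 0 else 1

-- For a non-constant word one peak is exhibited, and `peak-unique` makes the count exactly one.
pk-build : (v : Vec Bool (suc m)) → pk (build v) ≡ wordPeaks v
pk-build {m} (x ∷ v) with v ≟ᵛ replicate m x
... | yes refl = count-tabulate≡0 (peakAt? (build (x ∷ v))) id (build-replicate-noPeak x)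
... | no v≢    = let i , p = build-peak x v v≢ in
  count-tabulate≡1 (peakAt? (build (x ∷ v))) id i p
    (λ j → peak-unique (build (x ∷ v)) (build-noValley (x ∷ v)) i j p)

-- Counting words

WordsWithPeaks : (m k : ℕ) → Set
WordsWithPeaks m k = ∃ λ (v : Vec Bool (suc m)) → wordPeaks v ≡ k

words-≡ : ∀ {k} {v w : WordsWithPeaks m k} → proj₁ v ≡ proj₁ w → v ≡ w
words-≡ {v = v , p} {w = .v , q} refl = cong (v ,_) (ℕ.≡-irrelevant p q)

-- The map back is `build`. The map forth takes the word found by `build-surjective`;
-- `build-injective` makes it independent of the avoidance proofs.
avoiders↔words : ∀ m k → Inverse (AvoidersWithPeaks pattern213 pattern312 (suc (suc m)) k)
                                 (setoid (WordsWithPeaks m k))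
avoiders↔words m k = record
  { to        = to
  ; from      = from
  ; to-cong   = λ {σ} {τ} → to-cong {σ} {τ}
  ; from-cong = λ { refl i → refl }
  ; inverse   = (λ {v} {σ} e → words-≡ (build-injective (proj₁ (to σ)) (proj₁ v) λ i →
                   trans (build-word σ i) (e i)))
              , (λ { {σ} refl i → build-word σ i })
  }
  where
  Avoiders : Setoid 0ℓ 0ℓ
  Avoiders = AvoidersWithPeaks pattern213 pattern312 (suc (suc m)) k

  word : (σ : Setoid.Carrier Avoiders) → ∃ λ v → build v ≈ proj₁ σ
  word (π , av , av′ , _) = build-surjective π (avoids⇒noValley π av av′)

  build-word : (σ : Setoid.Carrier Avoiders) → build (proj₁ (word σ)) ≈ proj₁ σ
  build-word σ = proj₂ (word σ)

  to : Setoid.Carrier Avoiders → WordsWithPeaks m k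
  to σ@(π , _ , _ , pk≡k) = v ,
    trans (sym (pk-build v)) (trans (pk-cong (build v) π (build-word σ)) pk≡k)
    where v = proj₁ (word σ)

  to-cong : ∀ {σ τ} → Setoid._≈_ Avoiders σ τ → to σ ≡ to τ
  to-cong {σ} {τ} σ≈τ = words-≡ (build-injective _ _ λ i →
    trans (build-word σ i) (trans (σ≈τ i) (sym (build-word τ i))))

  from : WordsWithPeaks m k → Setoid.Carrier Avoiders
  from (v , e) = build v
    , noValley⇒avoids (build v) pattern213 (s≤s z≤n) (s≤s z≤n) (build-noValley v)
    , noValley⇒avoids (build v) pattern312 (s≤s z≤n) (s≤s z≤n) (build-noValley v)
    , trans (pk-build v) e

wordPeaks-const : ∀ m x → wordPeaks (replicate (suc m) x) ≡ 0
wordPeaks-const m x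
  rewrite dec-true (replicate m x ≟ᵛ replicate m x) refl = refl

wordPeaks-nonconst : ∀ x (v : Vec Bool m) → v ≢ replicate m x → wordPeaks (x ∷ v) ≡ 1
wordPeaks-nonconst {m} x v v≢ rewrite dec-false (v ≟ᵛ replicate m x) v≢ = refl

wordPeaks≡0⇒const : ∀ x (v : Vec Bool m) → wordPeaks (x ∷ v) ≡ 0 → v ≡ replicate m x
wordPeaks≡0⇒const {m} x v e with v ≟ᵛ replicate m x
... | yes v≡ = v≡
... | no  _  with () ← e

wordPeaks≡1⇒nonconst : ∀ x (v : Vec Bool m) → wordPeaks (x ∷ v) ≡ 1 → v ≢ replicate m x
wordPeaks≡1⇒nonconst {m} x v e refl with () ← trans (sym (wordPeaks-const m x)) e

wordPeaks≤1 : (v : Vec Bool (suc m)) → wordPeaks v ℕ.≤ 1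
wordPeaks≤1 {m} (x ∷ v) with does (v ≟ᵛ replicate m x)
... | true  = z≤n
... | false = s≤s z≤n

constantWords↔ : ∀ m → WordsWithPeaks m 0 ↔ Bool
constantWords↔ m = mk↔ₛ′
  (λ { (x ∷ _ , _) → x })
  (λ x → replicate (suc m) x , wordPeaks-const m x)
  (λ _ → refl)
  (λ { (x ∷ v , e) → words-≡ (cong (x ∷_) (sym (wordPeaks≡0⇒const x v e))) })

-- Once the head `x` is fixed, the tail is any word except `replicate m x`. Punching the index of
-- that word out of `Fin (suc N)` leaves `Fin N`.
nonconstantWords↔ : ∀ {N} → Vec Bool m ↔ Fin (suc N) → WordsWithPeaks m 1 ↔ (Bool × Fin N)
nonconstantWords↔ {m} {N} I = mk↔ₛ′ to from to∘from from∘to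
  where
  open Inverse I renaming (to to index; from to word) using (strictlyInverseˡ; strictlyInverseʳ)

  constIndex : Bool → Fin (suc N)
  constIndex x = index (replicate m x)

  index-≢ : ∀ {x v} → v ≢ replicate m x → constIndex x ≢ index v
  index-≢ v≢ e = v≢ (trans (sym (strictlyInverseʳ _)) (trans (cong word (sym e)) (strictlyInverseʳ _)))

  word-≢ : ∀ x i → word (punchIn (constIndex x) i) ≢ replicate m x
  word-≢ x i e = punchInᵢ≢i (constIndex x) i (trans (sym (strictlyInverseˡ _)) (cong index e))

  to : WordsWithPeaks m 1 → Bool × Fin N
  to (x ∷ v , e) = x , punchOut (index-≢ (wordPeaks≡1⇒nonconst x v e))

  from : Bool × Fin N → WordsWithPeaks m 1
  from (x , i) = x ∷ word (punchIn (constIndex x) i) , wordPeaks-nonconst x _ (word-≢ x i)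

  to∘from : ∀ y → to (from y) ≡ y
  to∘from (x , i) = cong (x ,_)
    -- `punchOut-cong` also bridges the two different proofs of inequality.
    (trans (punchOut-cong (constIndex x) (strictlyInverseˡ _)) (punchOut-punchIn (constIndex x)))

  from∘to : ∀ w → from (to w) ≡ w
  from∘to (x ∷ v , e) = words-≡ (cong (x ∷_)
    (trans (cong word (punchIn-punchOut _)) (strictlyInverseʳ v)))

∷↔× : Vec Bool (suc m) ↔ (Bool × Vec Bool m)
∷↔× = mk↔ₛ′ (λ { (x ∷ v) → x , v }) (λ (x , v) → x ∷ v) (λ _ → refl) (λ { (_ ∷ _) → refl })

words↔Fin : ∀ m → Vec Bool m ↔ Fin (2 ^ m)
words↔Fin zero    = mk↔ₛ′ (λ _ → 0F) (λ _ → []) (λ { 0F → refl ; (suc ()) }) (λ { [] → refl })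
words↔Fin (suc m) =
  ↔-trans ∷↔× (↔-trans (↔-sym 2↔Bool ×-↔ words↔Fin m) (↔-sym *↔×))

wordsWithPeaks↔Fin : ∀ m k → WordsWithPeaks m k ↔ Fin (peakFormula (suc (suc m)) k)
wordsWithPeaks↔Fin m 0 = ↔-trans (constantWords↔ m) (↔-sym 2↔Bool)
wordsWithPeaks↔Fin m 1 =
  -- The first cast writes 2^m as a successor, so that one tail can be excluded for each head. This
  -- leaves 2 (2^m - 1) words, and the last cast distributes the product to 2^(m+1) - 2, the value
  -- at n = m + 2.
  ↔-trans (nonconstantWords↔ (↔-trans (words↔Fin m) (cast-id 2^m≡1+pred)))
  (↔-trans (↔-sym 2↔Bool ×-↔ ↔-id _)
  (↔-trans (↔-sym *↔×) (cast-id (ℕ.*-distribˡ-∸ 2 (2 ^ m) 1))))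
  where
  2^m≡1+pred : 2 ^ m ≡ suc (pred (2 ^ m))
  2^m≡1+pred = sym (ℕ.suc-pred (2 ^ m) {{ℕ.m^n≢0 2 m}})
wordsWithPeaks↔Fin m (suc (suc k)) = mk↔ₛ′
  (λ w → ⊥-elim (impossible w)) (λ ()) (λ ()) (λ w → ⊥-elim (impossible w))
  where
  impossible : ¬ WordsWithPeaks m (suc (suc k))
  impossible (v , e) with s≤s () ← subst (ℕ._≤ 1) e (wordPeaks≤1 v)

proposition8 : ∀ (n k : ℕ) → n ≥ 2 →
    HasCardinality (AvoidersWithPeaks pattern213 pattern312 n k) (peakFormula n k)
proposition8 (suc (suc m)) k (s≤s (s≤s _)) =
  inverse (avoiders↔words m k) (wordsWithPeaks↔Fin m k)
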